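{- Let $n \ge 1$ be an integer and let $A \subseteq \mathbb{Z}_n \setminus \{0\}$ with $|A| = 6$. Then there is an ordering $(a_1,\dots,a_6)$ of the elements of $A$ such that the partial sums $s_j = \sum_{i=1}^{j} a_i$ ($1 \le j \le 6$, computed in $\mathbb{Z}_n$) are pairwise distinct. -}

module Defs where

open import Data.Nat using (ℕ; zero; suc; NonZero; _+_)
open import Data.Nat.DivMod using (_mod_)
open import Data.Fin using (Fin; toℕ; zero; suc)

_+ₙ_ : ∀ {n} .{{_ : NonZero n}} → Fin n → Fin n → Fin n
_+ₙ_ {n} x y = (toℕ x + toℕ y) mod n

-- Partial sums in ℤ_n of a sequence a : Fin k → ℤ_n:
--   partialSum a j = a 0 +ₙ a 1 +ₙ ... +ₙ a j   (0-indexed; j corresponds to the paper's j+1).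
partialSum : ∀ {n k} .{{_ : NonZero n}} → (Fin (suc k) → Fin n) → Fin (suc k) → Fin n
partialSum a zero = a zero
partialSum {k = suc k} a (suc j) = a zero +ₙ partialSum (λ i → a (suc i)) j

{-# OPTIONS --safe #-}
-- The partial sums of a₀, …, a₅ are distinct as soon as no interval of consecutive terms
-- avoiding a₀ sums to zero.  All that is used about zero-sum subsets of A is that two of them
-- cannot differ by adding one element or by exchanging one element for another, since the
-- elements are nonzero and distinct.  With this rule alone, a finite search, splitting on whether
-- a given subset has zero sum, always ends in an ordering without a zero-sum interval.

module Submission where

open import Defs
open import Data.Bool using (true; false; if_then_else_)
open import Data.Fin using (Fin; zero; suc; toℕ)
open import Data.Fin.Permutation as Perm using (Permutation; Permutation′; _⟨$⟩ʳ_; _⟨$⟩ˡ_; insert)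
open import Data.Fin.Properties using (toℕ-injective; toℕ<n; toℕ-fromℕ<; suc-injective)
open import Data.Fin.Subset using (Subset; _∈_; ∣_∣)
open import Data.List as List using (List; []; _∷_; _++_; map; filter; foldr; length; concatMap; allFin)
open import Data.List.Relation.Unary.All using (All; []; _∷_)
import Data.List.Relation.Unary.All.Properties as All
open import Data.List.Relation.Unary.Any as Any using (Any; any?)
import Data.List.Relation.Unary.Any.Properties as Any
open import Data.Maybe as Maybe using (Maybe; just; nothing; from-just; _<∣>_)
open import Data.Nat using (ℕ; zero; suc; NonZero; _+_; _*_; _∸_; _≤_; _<ᵇ_)
open import Data.Nat.Divisibility using (_∣_; _∣?_; m%n≡0⇒n∣m; n∣m⇒m%n≡0; _∣0; ∣-refl)
open import Data.Nat.DivMod using (_%_; m<n⇒m%n≡m; %-remove-+ˡ; %-distribˡ-+)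
open import Data.Nat.Properties as ℕ using (<⇒≤; +-assoc; +-comm; +-identityʳ; m∸n+n≡m)
open import Data.Product using (∃; _×_; _,_)
open import Data.Sum using (_⊎_; inj₁; inj₂)
open import Data.Vec as Vec using (Vec; []; _∷_; _[_]%=_; here; there)
open import Data.Vec.Properties using (≡-dec)
open import Function using (_∘_; Injection)
open import Function.Definitions using (Injective)
open import Function.Properties.Inverse using (↔⇒↣)
open import Level using (0ℓ)
open import Relation.Binary.Core using (Rel)
open import Relation.Binary.Definitions using (DecidableEquality)
open import Relation.Binary.PropositionalEquality
  using (_≡_; _≢_; refl; sym; trans; cong; subst; module ≡-Reasoning)
open import Relation.Nullary using (¬_; yes; no; ¬?; contradiction)
open import Relation.Nullary.Decidable using (dec⇒maybe; decidable-stable)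
open import Relation.Unary using (Pred; Decidable)

-- A search by case splits over an abstract predicate.

discard : {A : Set} {Q : Pred A 0ℓ} → (∀ x → Maybe (Q x)) → List A → List A
discard q []       = []
discard q (x ∷ xs) with q x
... | just _  = discard q xs
... | nothing = x ∷ discard q xs

-- Only the answers `just` carry a proof, so an incomplete test `q` may keep too many elements but
-- never makes the search unsound.
discard⁻ : {A : Set} {P Q : Pred A 0ℓ} (q : ∀ x → Maybe (Q x)) → (∀ {x} → Q x → P x) →
  ∀ xs → All P (discard q xs) → All P xs
discard⁻ q Q⇒P []       _ = []
discard⁻ q Q⇒P (x ∷ xs) ps with q x
... | just Qx = Q⇒P Qx ∷ discard⁻ q Q⇒P xs ps
discard⁻ q Q⇒P (x ∷ xs) (p ∷ ps) | nothing = p ∷ discard⁻ q Q⇒P xs ps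

map-discard⁻ : {A : Set} {P Q : Pred A 0ℓ} (q : ∀ x → Maybe (Q x)) → (∀ {x} → Q x → P x) →
  ∀ xss → Any (All P) (map (discard q) xss) → Any (All P) xss
map-discard⁻ q Q⇒P xss = Any.map (discard⁻ q Q⇒P _) ∘ Any.map⁻

shortest : {A : Set} → List (List A) → List A
shortest []         = []
shortest (xs ∷ xss) = foldr (λ ys zs → if length ys <ᵇ length zs then ys else zs) xs xss

module _ {A : Set} (_≟_ : DecidableEquality A)
         {_#_ : Rel A 0ℓ} (_#?_ : ∀ x y → Maybe (x # y)) where

  open import Data.List.Membership.DecPropositional _≟_ using (_∈?_)

  Compatible : Pred A 0ℓ → Set
  Compatible P = ∀ {x y} → x # y → ¬ P x → P y

  -- Each inner list holds the conditions on one candidate. Quantifying over every compatible `P`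
  -- leaves a statement about the lists alone, which a computation can settle.
  Solvable : List (List A) → Set₁
  Solvable xss = ∀ {P : Pred A 0ℓ} → Decidable P → Compatible P → Any (All P) xss

  empty? : Decidable {A = List A} (_≡ [])
  empty? []      = yes refl
  empty? (_ ∷ _) = no λ ()

  -- Case split on whether P holds at a chosen x; the first argument bounds the depth, and
  -- taking x from the shortest candidate only serves to keep the tree small.
  solve : ℕ → ∀ xss → Maybe (Solvable xss)
  solve zero    xss = nothing
  solve (suc d) xss with any? empty? xss
  ... | yes e = just λ _ _ → Any.map (λ { refl → [] }) e
  ... | no  _ with shortest xss
  -- Empty candidates are caught above, so `[]` can only be the default of `shortest` on an empty
  -- list: every candidate has been ruled out.
  ...   | []    = nothing
  ...   | x ∷ _ with solve d (map (discard (dec⇒maybe ∘ (x ≟_))) xss)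
  ...     | nothing = nothing
  -- If `P x` fails, the candidates containing `x` are lost, but every `y` with `x # y` is gained.
  ...     | just holds with solve d (map (discard (x #?_)) (filter (¬? ∘ (x ∈?_)) xss))
  ...       | nothing = nothing
  ...       | just fails = just branch
    where
    branch : Solvable xss
    branch P? compatible with P? x
    ... | yes Px = map-discard⁻ _ (λ { refl → Px }) xss (holds P? compatible)
    ... | no ¬Px = Any.filter⁻ (¬? ∘ (x ∈?_))
                     (map-discard⁻ _ (λ x#y → compatible x#y ¬Px) _ (fails P? compatible))

-- Sums of terms as vectors of coefficients.

value : ∀ {m} → (Fin m → ℕ) → Vec ℕ m → ℕ
value w []      = 0
value w (k ∷ c) = k * w zero + value (w ∘ suc) c

value-suc : ∀ {m} (w : Fin m → ℕ) c i → value w (c [ i ]%= suc) ≡ value w c + w i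
value-suc w (k ∷ c) zero = begin
  (w zero + k * w zero) + v   ≡⟨ +-assoc (w zero) _ v ⟩
  w zero + (k * w zero + v)   ≡⟨ +-comm (w zero) _ ⟩
  (k * w zero + v) + w zero   ∎
  where
  open ≡-Reasoning
  v = value (w ∘ suc) c
value-suc w (k ∷ c) (suc i) =
  trans (cong (k * w zero +_) (value-suc (w ∘ suc) c i)) (sym (+-assoc (k * w zero) _ _))

value-zero : ∀ {m} (w : Fin m → ℕ) → value w (Vec.replicate m 0) ≡ 0
value-zero {zero}  w = refl
value-zero {suc m} w = value-zero (w ∘ suc)

-- Coefficients in ℕ rather than booleans make this an increment with no side condition on entry
-- `i`.
Extends : ∀ {m} → Rel (Vec ℕ m) 0ℓ
Extends c d = ∃ λ i → d ≡ c [ i ]%= suc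

extends? : ∀ {m} (c d : Vec ℕ m) → Maybe (Extends c d)
extends? []      []      = nothing
extends? (k ∷ c) (l ∷ d) with k ℕ.≟ l
... | yes refl = Maybe.map (λ { (i , refl) → suc i , refl }) (extends? c d)
... | no  _ with l ℕ.≟ suc k | ≡-dec ℕ._≟_ d c
...   | yes refl | yes refl = just (zero , refl)
...   | _        | _        = nothing

-- Incrementing on both sides avoids subtraction: over ℤ, `c` - `d` is the unit vector at `j` minus
-- the one at `i`.
Exchange : ∀ {m} → Rel (Vec ℕ m) 0ℓ
Exchange c d = ∃ λ i → ∃ λ j → i ≢ j × c [ i ]%= suc ≡ d [ j ]%= suc

exchange? : ∀ {m} (c d : Vec ℕ m) → Maybe (Exchange c d)
exchange? []      []      = nothing
exchange? (k ∷ c) (l ∷ d) with k ℕ.≟ l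
... | yes refl = Maybe.map
  (λ (i , j , i≢j , eq) → suc i , suc j , i≢j ∘ suc-injective , cong (k ∷_) eq)
  (exchange? c d)
... | no  _ with l ℕ.≟ suc k
-- At the first differing entry `d` is ahead by one, so in the remaining entries `c` must be ahead
-- by one unit.
...   | yes refl = Maybe.map (λ { (j , refl) → zero , suc j , (λ ()) , refl }) (extends? d c)
...   | no  _ with k ℕ.≟ suc l
...     | yes refl = Maybe.map (λ { (i , refl) → suc i , zero , (λ ()) , refl }) (extends? c d)
...     | no  _ = nothing

-- c # d means that c − d is ± a unit vector or a difference of two of them, so that the two
-- combinations of distinct nonzero residues cannot both vanish.
_#_ : ∀ {m} → Rel (Vec ℕ m) 0ℓ
c # d = Extends c d ⊎ Extends d c ⊎ Exchange c d

_#?_ : ∀ {m} (c d : Vec ℕ m) → Maybe (c # d)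
c #? d = Maybe.map inj₁ (extends? c d)
     <∣> Maybe.map (inj₂ ∘ inj₁) (extends? d c)
     <∣> Maybe.map (inj₂ ∘ inj₂) (exchange? c d)

-- Orderings and their intervals.

partialCoefficients : ∀ {m k} → (Fin (suc k) → Fin m) → Fin (suc k) → Vec ℕ m
partialCoefficients p zero = Vec.replicate _ 0 [ p zero ]%= suc
partialCoefficients {k = suc k} p (suc j) = partialCoefficients (p ∘ suc) j [ p zero ]%= suc

intervals : ∀ {m k} → (Fin k → Fin m) → List (Vec ℕ m)
intervals {k = zero}  p = []
intervals {k = suc k} p = List.tabulate (partialCoefficients p) ++ intervals (p ∘ suc)

-- `insert zero j` sends `zero` to `j`, so `j` is the index of the first term.
permutations : ∀ n → List (Permutation′ n)
permutations zero    = Perm.id ∷ []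
permutations (suc n) = concatMap (λ j → map (insert zero j) (permutations n)) (allFin (suc n))

innerIntervals : ∀ {n} → Permutation′ (suc n) → List (Vec ℕ (suc n))
innerIntervals π = intervals ((π ⟨$⟩ʳ_) ∘ suc)

-- No modulus and no set occur here, so one search serves them all. `P` stands for having a nonzero
-- sum; the empty sum vanishes, whence `¬ P` at the zero vector.
Orderable : ℕ → Set₁
Orderable n = {P : Pred (Vec ℕ (suc n)) 0ℓ} → Decidable P → Compatible (≡-dec ℕ._≟_) _#?_ P →
  ¬ P (Vec.replicate (suc n) 0) → ∃ λ π → All P (innerIntervals π)

findOrdering : ∀ {n} → ℕ → List (Permutation′ (suc n)) → Maybe (Orderable n)
findOrdering {n} depth πs = Maybe.map
  (λ solution P? compatible ¬P0 → Any.satisfied (Any.map⁻ {f = innerIntervals} {xs = πs}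
    -- The zero vector is related exactly to the unit vectors, so compatibility gives `P` for single
    -- terms, which are discarded before the search.
    (map-discard⁻ (zeros #?_) (λ 0#c → compatible 0#c ¬P0) _ (solution P? compatible))))
  (solve (≡-dec ℕ._≟_) _#?_ depth (map (discard (zeros #?_)) (map innerIntervals πs)))
  where
  zeros = Vec.replicate (suc n) 0

-- Two choices of first term suffice: a₁ + ⋯ + a₅ and a₀ + a₂ + ⋯ + a₅ cannot both vanish.
candidates : List (Permutation′ 6)
candidates = concatMap (λ j → map (insert zero j) (permutations 5)) (zero ∷ suc zero ∷ [])

goodOrdering : Orderable 5
-- This has the required type only because the search evaluates to `just`; 20 merely bounds the
-- number of nested case splits.
goodOrdering = from-just (findOrdering 20 candidates)

-- Residues and partial sums modulo `n`.

module _ {n : ℕ} .{{_ : NonZero n}} where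

  open ≡-Reasoning

  toℕ-% : (x : Fin n) → toℕ x % n ≡ toℕ x
  toℕ-% x = m<n⇒m%n≡m (toℕ<n x)

  toℕ-+ₙ : (x y : Fin n) → toℕ (x +ₙ y) ≡ (toℕ x + toℕ y) % n
  toℕ-+ₙ x y = toℕ-fromℕ< _

  -- As `m ≤ n`, the number `n ∸ m` is an additive inverse of `m` modulo `n`; adding it to both
  -- sides cancels `m`.
  +-%-cancelˡ : ∀ m {k l} → m ≤ n → (m + k) % n ≡ (m + l) % n → k % n ≡ l % n
  +-%-cancelˡ m {k} {l} m≤n eq = trans (sym (shift k)) (trans step (shift l))
    where
    shift : ∀ o → ((n ∸ m) + (m + o)) % n ≡ o % n
    shift o = begin
      ((n ∸ m) + (m + o)) % n   ≡⟨ cong (_% n) (sym (+-assoc (n ∸ m) m o)) ⟩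
      ((n ∸ m) + m + o) % n     ≡⟨ cong (λ h → (h + o) % n) (m∸n+n≡m m≤n) ⟩
      (n + o) % n               ≡⟨ %-remove-+ˡ o ∣-refl ⟩
      o % n                     ∎
    step : ((n ∸ m) + (m + k)) % n ≡ ((n ∸ m) + (m + l)) % n
    step = begin
      ((n ∸ m) + (m + k)) % n             ≡⟨ %-distribˡ-+ (n ∸ m) (m + k) n ⟩
      ((n ∸ m) % n + (m + k) % n) % n     ≡⟨ cong (λ h → ((n ∸ m) % n + h) % n) eq ⟩
      ((n ∸ m) % n + (m + l) % n) % n     ≡⟨ %-distribˡ-+ (n ∸ m) (m + l) n ⟨
      ((n ∸ m) + (m + l)) % n             ∎

  +ₙ-cancelˡ : (x y z : Fin n) → x +ₙ y ≡ x +ₙ z → y ≡ z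
  +ₙ-cancelˡ x y z eq = toℕ-injective (begin
    toℕ y       ≡⟨ toℕ-% y ⟨
    toℕ y % n   ≡⟨ +-%-cancelˡ (toℕ x) (<⇒≤ (toℕ<n x)) (begin
      (toℕ x + toℕ y) % n   ≡⟨ toℕ-+ₙ x y ⟨
      toℕ (x +ₙ y)          ≡⟨ cong toℕ eq ⟩
      toℕ (x +ₙ z)          ≡⟨ toℕ-+ₙ x z ⟩
      (toℕ x + toℕ z) % n   ∎) ⟩
    toℕ z % n   ≡⟨ toℕ-% z ⟩
    toℕ z       ∎)

  x≡x+ₙy⇒y≡0 : (x y : Fin n) → x ≡ x +ₙ y → toℕ y ≡ 0
  x≡x+ₙy⇒y≡0 x y eq = begin
    toℕ y       ≡⟨ toℕ-% y ⟨
    toℕ y % n   ≡⟨ +-%-cancelˡ (toℕ x) (<⇒≤ (toℕ<n x)) (begin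
      (toℕ x + toℕ y) % n   ≡⟨ toℕ-+ₙ x y ⟨
      toℕ (x +ₙ y)          ≡⟨ cong toℕ eq ⟨
      toℕ x                 ≡⟨ toℕ-% x ⟨
      toℕ x % n             ≡⟨ cong (_% n) (+-identityʳ (toℕ x)) ⟨
      (toℕ x + 0) % n       ∎) ⟩
    0 % n       ≡⟨ n∣m⇒m%n≡0 0 n (n ∣0) ⟩
    0           ∎

  module _ {m : ℕ} (a : Fin m → Fin n) where

    -- The instance of `P` for which the result of the search is used.
    NonZeroSum : Pred (Vec ℕ m) 0ℓ
    NonZeroSum c = ¬ n ∣ value (toℕ ∘ a) c

    nonZeroSum? : Decidable NonZeroSum
    nonZeroSum? c = ¬? (n ∣? value (toℕ ∘ a) c)

    zeros-¬NonZeroSum : ¬ NonZeroSum (Vec.replicate m 0)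
    zeros-¬NonZeroSum nz = nz (subst (n ∣_) (sym (value-zero (toℕ ∘ a))) (n ∣0))

    partialSum-coefficients : ∀ {k} (p : Fin (suc k) → Fin m) j →
      toℕ (partialSum (a ∘ p) j) ≡ value (toℕ ∘ a) (partialCoefficients p j) % n
    partialSum-coefficients p zero = begin
      toℕ (a (p zero))                   ≡⟨ toℕ-% (a (p zero)) ⟨
      toℕ (a (p zero)) % n               ≡⟨ cong (λ v → (v + toℕ (a (p zero))) % n) (value-zero (toℕ ∘ a)) ⟨
      (value (toℕ ∘ a) (Vec.replicate m 0) + toℕ (a (p zero))) % n
                                         ≡⟨ cong (_% n) (value-suc (toℕ ∘ a) (Vec.replicate m 0) (p zero)) ⟨
      value (toℕ ∘ a) (Vec.replicate m 0 [ p zero ]%= suc) % n   ∎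
    partialSum-coefficients {suc k} p (suc j) = begin
      toℕ (x +ₙ s)          ≡⟨ toℕ-+ₙ x s ⟩
      (toℕ x + toℕ s) % n   ≡⟨ cong (λ h → (toℕ x + h) % n) (partialSum-coefficients (p ∘ suc) j) ⟩
      (toℕ x + v % n) % n   ≡⟨ cong (λ h → (h + v % n) % n) (toℕ-% x) ⟨
      (toℕ x % n + v % n) % n   ≡⟨ %-distribˡ-+ (toℕ x) v n ⟨
      (toℕ x + v) % n       ≡⟨ cong (_% n) (+-comm (toℕ x) v) ⟩
      (v + toℕ x) % n       ≡⟨ cong (_% n) (value-suc (toℕ ∘ a) c (p zero)) ⟨
      value (toℕ ∘ a) (partialCoefficients p (suc j)) % n   ∎
      where
      x = a (p zero)
      s = partialSum (a ∘ p ∘ suc) j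
      c = partialCoefficients (p ∘ suc) j
      v = value (toℕ ∘ a) c

    partialSum≢0 : ∀ {k} (p : Fin (suc k) → Fin m) → All NonZeroSum (intervals p) →
      ∀ j → toℕ (partialSum (a ∘ p) j) ≢ 0
    partialSum≢0 p nz j eq =
      All.tabulate⁻ {f = partialCoefficients p} (All.++⁻ˡ _ nz) j
        (m%n≡0⇒n∣m _ n (trans (sym (partialSum-coefficients p j)) eq))

    -- At two later indices the common first term cancels, leaving the same question for `p ∘ suc`.
    -- If just one index is `zero`, cancelling leaves a vanishing interval that starts at the second
    -- term.
    partialSum-injective : ∀ {k} (p : Fin (suc k) → Fin m) →
      All NonZeroSum (intervals (p ∘ suc)) → Injective _≡_ _≡_ (partialSum (a ∘ p))
    partialSum-injective p nz {zero} {zero} _ = refl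
    partialSum-injective {suc k} p nz {zero} {suc j} eq =
      contradiction (x≡x+ₙy⇒y≡0 _ _ eq) (partialSum≢0 (p ∘ suc) nz j)
    partialSum-injective {suc k} p nz {suc i} {zero} eq =
      contradiction (x≡x+ₙy⇒y≡0 _ _ (sym eq)) (partialSum≢0 (p ∘ suc) nz i)
    partialSum-injective {suc k} p nz {suc i} {suc j} eq =
      cong suc (partialSum-injective (p ∘ suc) (All.++⁻ʳ _ nz) (+ₙ-cancelˡ _ _ _ eq))

    module _ (a-injective : Injective _≡_ _≡_ a) (a≢0 : ∀ i → toℕ (a i) ≢ 0) where

      ¬Extends : ∀ {c d} → Extends c d →
        n ∣ value (toℕ ∘ a) c → ¬ n ∣ value (toℕ ∘ a) d
      ¬Extends {c} (i , refl) n∣c n∣d = a≢0 i (begin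
        toℕ (a i)                                ≡⟨ toℕ-% (a i) ⟨
        toℕ (a i) % n                            ≡⟨ %-remove-+ˡ _ n∣c ⟨
        (value (toℕ ∘ a) c + toℕ (a i)) % n      ≡⟨ cong (_% n) (value-suc (toℕ ∘ a) c i) ⟨
        value (toℕ ∘ a) (c [ i ]%= suc) % n      ≡⟨ n∣m⇒m%n≡0 _ n n∣d ⟩
        0                                        ∎)

      -- If both sums vanished, the common increment of `c` and `d` would have residue `a i` and
      -- also `a j`, against injectivity of `a`.
      ¬Exchange : ∀ {c d} → Exchange c d →
        n ∣ value (toℕ ∘ a) c → ¬ n ∣ value (toℕ ∘ a) d
      ¬Exchange {c} {d} (i , j , i≢j , eq) n∣c n∣d = i≢j (a-injective (toℕ-injective (begin
        toℕ (a i)                                ≡⟨ residue c i n∣c ⟩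
        value (toℕ ∘ a) (c [ i ]%= suc) % n      ≡⟨ cong (λ e → value (toℕ ∘ a) e % n) eq ⟩
        value (toℕ ∘ a) (d [ j ]%= suc) % n      ≡⟨ residue d j n∣d ⟨
        toℕ (a j)                                ∎)))
        where
        residue : ∀ e l → n ∣ value (toℕ ∘ a) e →
          toℕ (a l) ≡ value (toℕ ∘ a) (e [ l ]%= suc) % n
        residue e l n∣e = begin
          toℕ (a l)                              ≡⟨ toℕ-% (a l) ⟨
          toℕ (a l) % n                          ≡⟨ %-remove-+ˡ _ n∣e ⟨
          (value (toℕ ∘ a) e + toℕ (a l)) % n    ≡⟨ cong (_% n) (value-suc (toℕ ∘ a) e l) ⟨
          value (toℕ ∘ a) (e [ l ]%= suc) % n    ∎

      nonZeroSum-compatible : Compatible (≡-dec ℕ._≟_) _#?_ NonZeroSum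
      -- The failure of `NonZeroSum c` is a doubly negated divisibility, which decidability turns
      -- into a divisibility.
      nonZeroSum-compatible {c} {d} c#d ¬nz with decidable-stable (n ∣? value (toℕ ∘ a) c) ¬nz | c#d
      ... | n∣c | inj₁ ext        = ¬Extends ext n∣c
      ... | n∣c | inj₂ (inj₁ ext) = λ n∣d → ¬Extends ext n∣d n∣c
      ... | n∣c | inj₂ (inj₂ exc) = ¬Exchange exc n∣c

-- Listing the elements of a subset, and the conclusion.

enumerate : ∀ {n} (A : Subset n) → Fin ∣ A ∣ → Fin n
enumerate (true  ∷ A) zero    = zero
enumerate (true  ∷ A) (suc i) = suc (enumerate A i)
enumerate (false ∷ A) i       = suc (enumerate A i)

enumerate-injective : ∀ {n} (A : Subset n) → Injective _≡_ _≡_ (enumerate A)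
enumerate-injective (true  ∷ A) {zero}  {zero}  _  = refl
enumerate-injective (true  ∷ A) {suc i} {suc j} eq =
  cong suc (enumerate-injective A (suc-injective eq))
enumerate-injective (false ∷ A) eq = enumerate-injective A (suc-injective eq)

enumerate-∈ : ∀ {n} (A : Subset n) i → enumerate A i ∈ A
enumerate-∈ (true  ∷ A) zero    = here
enumerate-∈ (true  ∷ A) (suc i) = there (enumerate-∈ A i)
enumerate-∈ (false ∷ A) i       = there (enumerate-∈ A i)

enumerate-surjective : ∀ {n} (A : Subset n) x → x ∈ A → ∃ λ i → enumerate A i ≡ x
enumerate-surjective (true  ∷ A) zero    here        = zero , refl
enumerate-surjective (true  ∷ A) (suc x) (there x∈A) with enumerate-surjective A x x∈A
... | i , refl = suc i , refl
enumerate-surjective (false ∷ A) (suc x) (there x∈A) with enumerate-surjective A x x∈A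
... | i , refl = i , refl

theorem2 : (n : ℕ) .{{_ : NonZero n}} (A : Subset n) →
    (∀ x → x ∈ A → toℕ x ≢ 0) → ∣ A ∣ ≡ 6 →
    ∃ λ (a : Fin 6 → Fin n) →
    (Injective _≡_ _≡_ a × (∀ i → a i ∈ A) × (∀ x → x ∈ A → ∃ λ i → a i ≡ x))
    × Injective _≡_ _≡_ (partialSum a)
theorem2 n A A∌0 ∣A∣≡6 = order
  (goodOrdering (nonZeroSum? a) (nonZeroSum-compatible a a-injective a≢0) (zeros-¬NonZeroSum a))
  where
  e : Permutation 6 ∣ A ∣
  -- For a variable `A` the equation cannot be matched with `refl`, so the six indices are carried
  -- over by a cast.
  e = Perm.cast-id (sym ∣A∣≡6)

  a : Fin 6 → Fin n
  a = enumerate A ∘ (e ⟨$⟩ʳ_)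

  a-injective : Injective _≡_ _≡_ a
  a-injective = Injection.injective (↔⇒↣ e) ∘ enumerate-injective A

  a≢0 : ∀ i → toℕ (a i) ≢ 0
  a≢0 i = A∌0 _ (enumerate-∈ A _)

  order : (∃ λ π → All (NonZeroSum a) (innerIntervals π)) →
    ∃ λ (b : Fin 6 → Fin n) →
      (Injective _≡_ _≡_ b × (∀ i → b i ∈ A) × (∀ x → x ∈ A → ∃ λ i → b i ≡ x))
      × Injective _≡_ _≡_ (partialSum b)
  order (π , nz) =
    a ∘ (π ⟨$⟩ʳ_) ,
    (Injection.injective (↔⇒↣ π) ∘ a-injective , (λ i → enumerate-∈ A _) , surjective) ,
    partialSum-injective a (π ⟨$⟩ʳ_) nz
    where
    surjective : ∀ x → x ∈ A → ∃ λ i → a (π ⟨$⟩ʳ i) ≡ x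
    surjective x x∈A with enumerate-surjective A x x∈A
    -- The index in the enumeration is pulled back through `e`, then through `π`.
    ... | i , refl = π ⟨$⟩ˡ (e ⟨$⟩ˡ i) ,
      cong (enumerate A) (trans (cong (e ⟨$⟩ʳ_) (Perm.inverseʳ π)) (Perm.inverseʳ e))
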